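{- Each satisfiable HyperCTL$^*$ sentence $\varphi$ has a model of size at most $\mathfrak{c}$, i.e. if some transition system satisfies $\varphi$, then there is a transition system with at most $\mathfrak{c}$ vertices that satisfies $\varphi$.
   Context: $\mathfrak{c}$ is the cardinality of the continuum. Let $\mathrm{AP}$ be a finite set of atomic propositions. A transition system $\mathcal{T}=(V,E,v_I,\lambda)$ consists of a set $V$ of vertices, a set $E\subseteq V\times V$ of directed edges, an initial vertex $v_I\in V$, and a labelling $\lambda\colon V\to 2^{\mathrm{AP}}$; its size is the cardinality of $V$. A path through $\mathcal{T}$ is an infinite sequence $\rho(0)\rho(1)\cdots$ of vertices with $(\rho(n),\rho(n+1))\in E$ for all $n\ge 0$. HyperCTL$^*$ formulas over $\mathrm{AP}$ are given by $\varphi ::= a_\pi\mid\neg\varphi\mid\varphi\vee\varphi\mid\mathbf{X}\varphi\mid\varphi\,\mathbf{U}\,\varphi\mid\exists\pi.\ \varphi\mid\forall\pi.\ \varphi$, where $a\in\mathrm{AP}$ and $\pi$ ranges over a fixed countable set $\mathcal{V}$ of path variables, and each temporal operator is required to appear in the scope of a path quantifier. Sentences are formulas without free variables. A path assignment $\Pi$ is a partial map from $\mathcal{V}$ to paths of $\mathcal{T}$; $\Pi_\emptyset$ has empty domain; $\Pi[\pi\to\rho]$ is $\Pi$ updated to map $\pi$ to $\rho$; $\Pi[j,\infty)$ maps each $\pi$ in the domain of $\Pi$ to the suffix of $\Pi(\pi)$ from position $j$ onwards. $\mathrm{rcnt}(\Pi)$ is the first vertex of $\Pi(\pi)$, where $\pi$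 is the path variable most recently added to $\Pi$, and it is $v_I$ if $\Pi$ is empty. Semantics: $(\mathcal{T},\Pi)\models a_\pi$ iff $a\in\lambda(\Pi(\pi)(0))$; Boolean connectives as usual; $(\mathcal{T},\Pi)\models\mathbf{X}\psi$ iff $(\mathcal{T},\Pi[1,\infty))\models\psi$; $(\mathcal{T},\Pi)\models\psi_1\mathbf{U}\psi_2$ iff there is $j\ge0$ with $(\mathcal{T},\Pi[j,\infty))\models\psi_2$ and $(\mathcal{T},\Pi[j',\infty))\models\psi_1$ for all $0\le j'<j$; $(\mathcal{T},\Pi)\models\exists\pi.\varphi$ (resp. $\forall\pi.\varphi$) iff for some path (resp. all paths) $\rho$ of $\mathcal{T}$ starting in $\mathrm{rcnt}(\Pi)$, $(\mathcal{T},\Pi[\pi\to\rho])\models\varphi$. For a sentence, $\mathcal{T}\models\varphi$ ("$\mathcal{T}$ is a model of $\varphi$") means $(\mathcal{T},\Pi_\emptyset)\models\varphi$; $\varphi$ is satisfiable if it has a model. -}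

module Defs where

open import Data.Bool using (Bool)
open import Data.Empty using (⊥)
open import Data.Fin using (Fin)
open import Data.Fin.Subset using (Subset; _∈_)
open import Data.Maybe using (Maybe; just; nothing)
open import Data.Maybe.Relation.Unary.Any using (Any)
open import Data.Nat using (ℕ; zero; suc; _+_; _<_; _≟_)
open import Data.Product using (Σ-syntax; _×_)
open import Data.Sum using (_⊎_)
open import Data.Unit using (⊤)
open import Function.Bundles using (Injection)
open import Level using (Level) renaming (suc to lsuc)
open import Relation.Binary.Core using (Rel)
open import Relation.Binary.PropositionalEquality using (_≡_; _≢_; setoid; _→-setoid_)
open import Relation.Nullary using (¬_; yes; no)

-- The finite set of atomic propositions is Fin k throughout.

record TransitionSystem (k : ℕ) (ℓ : Level) : Set (lsuc ℓ) where
  field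
    Vertex  : Set ℓ
    Edge    : Rel Vertex ℓ
    initial : Vertex
    label   : Vertex → Subset k

-- 𝔠 is the cardinality of ℕ → Bool, whose elements are compared pointwise.
SizeAtMostContinuum : ∀ {k ℓ} → TransitionSystem k ℓ → Set ℓ
SizeAtMostContinuum T = Injection (setoid Vertex) (ℕ →-setoid Bool)
  where open TransitionSystem T

PathVariable : Set
PathVariable = ℕ

infix  30 _⟨_⟩
infixr 25 ~_ 𝐗_
infixr 20 _∨_ _𝐔_
infixr 15 ∃[_]_ ∀[_]_

data Formula (k : ℕ) : Set where
  _⟨_⟩  : Fin k → PathVariable → Formula k
  ~_    : Formula k → Formula k
  _∨_   : Formula k → Formula k → Formula k
  𝐗_    : Formula k → Formula k
  _𝐔_   : Formula k → Formula k → Formula k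
  ∃[_]_ : PathVariable → Formula k → Formula k
  ∀[_]_ : PathVariable → Formula k → Formula k

-- Every temporal operator lies in the scope of some path quantifier.
Guarded : ∀ {k} → Formula k → Set
Guarded (a ⟨ π ⟩)  = ⊤
Guarded (~ φ)      = Guarded φ
Guarded (φ ∨ ψ)    = Guarded φ × Guarded ψ
Guarded (𝐗 φ)      = ⊥
Guarded (φ 𝐔 ψ)    = ⊥
Guarded (∃[ π ] φ) = ⊤
Guarded (∀[ π ] φ) = ⊤

_FreeIn_ : ∀ {k} → PathVariable → Formula k → Set
π FreeIn (a ⟨ π′ ⟩)  = π ≡ π′
π FreeIn (~ φ)       = π FreeIn φ
π FreeIn (φ ∨ ψ)     = π FreeIn φ ⊎ π FreeIn ψ
π FreeIn (𝐗 φ)       = π FreeIn φ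
π FreeIn (φ 𝐔 ψ)     = π FreeIn φ ⊎ π FreeIn ψ
π FreeIn (∃[ π′ ] φ) = π ≢ π′ × π FreeIn φ
π FreeIn (∀[ π′ ] φ) = π ≢ π′ × π FreeIn φ

record Sentence (k : ℕ) : Set where
  field
    formula : Formula k
    guarded : Guarded formula
    closed  : ∀ π → ¬ (π FreeIn formula)

module _ {k ℓ} (T : TransitionSystem k ℓ) where
  open TransitionSystem T

  record Path : Set ℓ where
    field
      at   : ℕ → Vertex
      edge : ∀ n → Edge (at n) (at (suc n))

  -- An assignment is given by its history of updates, since rcnt depends on
  -- which variable was added last; the partial map itself is lookup below.
  data PathAssignment : Set ℓ where
    Π∅     : PathAssignment
    _[_↦_] : PathAssignment → PathVariable → Path → PathAssignment

module _ {k ℓ} {T : TransitionSystem k ℓ} where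
  open TransitionSystem T
  open Path

  suffix : ℕ → Path T → Path T
  suffix j ρ .at n   = ρ .at (n + j)
  suffix j ρ .edge n = ρ .edge (n + j)

  lookup : PathAssignment T → PathVariable → Maybe (Path T)
  lookup Π∅             π′ = nothing
  lookup (Π [ π ↦ ρ ]) π′ with π ≟ π′
  ... | yes _ = just ρ
  ... | no  _ = lookup Π π′

  _[_,∞⟩ : PathAssignment T → ℕ → PathAssignment T
  Π∅            [ j ,∞⟩ = Π∅
  (Π [ π ↦ ρ ]) [ j ,∞⟩ = (Π [ j ,∞⟩) [ π ↦ suffix j ρ ]

  rcnt : PathAssignment T → Vertex
  rcnt Π∅            = initial
  rcnt (Π [ π ↦ ρ ]) = ρ .at 0

infix 4 _⊨[_]_ _⊨_

-- An atom whose path variable is unassigned is false; this never arises in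
-- evaluating a sentence from Π∅.
_⊨[_]_ : ∀ {k ℓ} (T : TransitionSystem k ℓ) → PathAssignment T → Formula k → Set ℓ
T ⊨[ Π ] a ⟨ π ⟩  = Any (λ ρ → a ∈ TransitionSystem.label T (Path.at ρ 0)) (lookup Π π)
T ⊨[ Π ] ~ φ      = ¬ (T ⊨[ Π ] φ)
T ⊨[ Π ] φ ∨ ψ    = (T ⊨[ Π ] φ) ⊎ (T ⊨[ Π ] ψ)
T ⊨[ Π ] 𝐗 φ      = T ⊨[ Π [ 1 ,∞⟩ ] φ
T ⊨[ Π ] φ 𝐔 ψ    =
  Σ[ j ∈ ℕ ] (T ⊨[ Π [ j ,∞⟩ ] ψ) × (∀ j′ → j′ < j → T ⊨[ Π [ j′ ,∞⟩ ] φ)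
T ⊨[ Π ] ∃[ π ] φ = Σ[ ρ ∈ Path T ] Path.at ρ 0 ≡ rcnt Π × (T ⊨[ Π [ π ↦ ρ ] ] φ)
T ⊨[ Π ] ∀[ π ] φ = (ρ : Path T) → Path.at ρ 0 ≡ rcnt Π → T ⊨[ Π [ π ↦ ρ ] ] φ

_⊨_ : ∀ {k ℓ} → TransitionSystem k ℓ → Sentence k → Set ℓ
T ⊨ φ = T ⊨[ Π∅ ] Sentence.formula φ

Satisfiable : ∀ {k} (ℓ : Level) → Sentence k → Set (lsuc ℓ)
Satisfiable {k} ℓ φ = Σ[ T ∈ TransitionSystem k ℓ ] T ⊨ φ

{-# OPTIONS --safe #-}

-- The hull of a model T is the term algebra over one initial vertex in which
-- every finite tuple of sequences of terms has, for each quantifier occurring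
-- in φ, a Skolem witness path.  Terms are well-founded countably branching
-- trees, hence at most 𝔠 many, and evaluating them in T preserves and reflects
-- the truth of all subformulas of φ.  Excluded middle, being stated for
-- arbitrary types, also serves as the choice operator that picks the witnesses.
module Submission where

open import Defs
open import Axiom.ExcludedMiddle using (ExcludedMiddle)
open import Axiom.Extensionality.Propositional using (Extensionality)
open import Data.Bool using (Bool; true; false)
open import Data.Empty using (⊥-elim)
open import Data.Fin using (Fin; toℕ)
open import Data.Fin.Properties using (toℕ-injective)
open import Data.Fin.Subset using (_∈_)
open import Data.List using (List; []; _∷_; _++_; length) renaming (lookup to _!_)
open import Data.List.Membership.Propositional using () renaming (_∈_ to _∈ˡ_)
open import Data.List.Relation.Binary.Subset.Propositional using (_⊆_)
open import Data.List.Relation.Binary.Subset.Propositional.Properties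
  using (⊆-refl; ⊆-trans; xs⊆xs++ys; xs⊆ys++xs; xs⊆x∷xs)
open import Data.List.Relation.Unary.Any using (here; index)
open import Data.List.Relation.Unary.Any.Properties using (lookup-index)
open import Data.Maybe.Relation.Unary.Any using (just)
open import Data.Nat using (ℕ; zero; suc; _+_; _≟_)
open import Data.Nat.Binary.Base using (ℕᵇ; zero; 2[1+_]; 1+[2_]; fromℕ)
  renaming (toℕ to toℕᵇ)
open import Data.Nat.Binary.Properties using (fromℕ-toℕ)
open import Data.Product using (Σ-syntax; _×_; _,_)
open import Data.Sum using (inj₁; inj₂)
open import Function using (_∘_)
open import Function.Bundles using (Injection)
open import Level using (Level; 0ℓ)
open import Relation.Binary.PropositionalEquality
  using (_≡_; _≗_; refl; sym; trans; cong; subst; subst₂; setoid; _→-setoid_)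
open import Relation.Nullary using (Dec; yes; no)
open import Relation.Nullary.Decidable using (True; toWitness; fromWitness)

-- Binary numerals in bijective base 2 serve as the nodes of the full binary
-- tree, so that a map ℕᵇ → Bool is a labelled tree with two subtrees.

private
  BitTree : Set
  BitTree = ℕᵇ → Bool

bitNode : Bool → BitTree → BitTree → BitTree
bitNode b s t zero     = b
bitNode b s t 2[1+ x ] = s x
bitNode b s t 1+[2 x ] = t x

numeral : ℕ → BitTree
numeral zero    x = false
numeral (suc n)   = bitNode true (numeral n) (numeral n)

-- The tree `s j` hangs to the left of the `j`-th node on the rightmost branch, so one tree stores
-- countably many.
family : (ℕ → BitTree) → BitTree
family s zero     = false
family s 2[1+ x ] = s 0 x
family s 1+[2 x ] = family (s ∘ suc) x

numeral-injective : ∀ m n → numeral m ≗ numeral n → m ≡ n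
numeral-injective zero    zero    eq = refl
numeral-injective zero    (suc n) eq with () ← eq zero
numeral-injective (suc m) zero    eq with () ← eq zero
numeral-injective (suc m) (suc n) eq = cong suc (numeral-injective m n (eq ∘ 2[1+_]))

family-injective : ∀ {s t} → family s ≗ family t → ∀ j → s j ≗ t j
family-injective eq zero    = eq ∘ 2[1+_]
family-injective eq (suc j) = family-injective (eq ∘ 1+[2_]) j

-- witness i n f stands for position n + 1 of the witness path of the i-th
-- quantifier under the assignment with paths f 0, f 1, …; position 0 is the
-- already existing rcnt of that assignment.
data Term (N : ℕ) : Set where
  root    : Term N
  witness : Fin N → ℕ → (ℕ → ℕ → Term N) → Term N

encode : ∀ {N} → Term N → BitTree
encode root            x = false
encode (witness i n f)   =
  bitNode true (bitNode false (numeral (toℕ i)) (numeral n))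
    (family λ j → family λ m → encode (f j m))

-- The bit at the top separates the constructors, and the subtrees determine their arguments. This
-- makes `f` and `f′` agree pointwise; `ext` turns that into an equation.
encode-injective : Extensionality 0ℓ 0ℓ → ∀ {N} (t u : Term N) → encode t ≗ encode u → t ≡ u
encode-injective ext root            root            eq = refl
encode-injective ext root            (witness _ _ _) eq with () ← eq zero
encode-injective ext (witness _ _ _) root            eq with () ← eq zero
encode-injective ext (witness i n f) (witness i′ n′ f′) eq
  with refl ← toℕ-injective (numeral-injective (toℕ i) (toℕ i′) (eq ∘ 2[1+_] ∘ 2[1+_]))
     | refl ← numeral-injective n n′ (eq ∘ 2[1+_] ∘ 1+[2_])
  = cong (witness i n) (ext λ j → ext λ m → encode-injective ext (f j m) (f′ j m)
      (family-injective (family-injective (eq ∘ 1+[2_]) j) m))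

Term↣2^ℕ : Extensionality 0ℓ 0ℓ → ∀ {N} → Injection (setoid (Term N)) (ℕ →-setoid Bool)
Term↣2^ℕ ext = record
  { to        = λ t → encode t ∘ fromℕ
  ; cong      = λ { refl _ → refl }
  ; injective = λ {t} {u} eq → encode-injective ext t u λ x →
      subst (λ y → encode t y ≡ encode u y) (fromℕ-toℕ x) (eq (toℕᵇ x))
  }

record Goal (k : ℕ) : Set where
  constructor goal
  field
    assigned   : List PathVariable  -- most recent first
    quantified : PathVariable
    body       : Formula k

goals : ∀ {k} → List PathVariable → Formula k → List (Goal k)
goals vs (a ⟨ π ⟩)  = []
goals vs (~ φ)      = goals vs φ
goals vs (φ ∨ ψ)    = goals vs φ ++ goals vs ψ
goals vs (𝐗 φ)      = goals vs φ
goals vs (φ 𝐔 ψ)    = goals vs φ ++ goals vs ψ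
goals vs (∃[ π ] φ) = goal vs π φ ∷ goals (π ∷ vs) φ
-- A counterexample to a universal formula is a witness for the negated body.
goals vs (∀[ π ] φ) = goal vs π (~ φ) ∷ goals (π ∷ vs) φ

module _ {k ℓ} {T : TransitionSystem k ℓ} where

  -- Shadowed variables are kept, so that the list runs in step with `positions`.
  variables : PathAssignment T → List PathVariable
  variables Π∅           = []
  variables (Π [ π ↦ ρ ]) = π ∷ variables Π

  variables-suffix : ∀ Π j → variables (Π [ j ,∞⟩) ≡ variables Π
  variables-suffix Π∅            j = refl
  variables-suffix (Π [ π ↦ ρ ]) j = cong (π ∷_) (variables-suffix Π j)

  -- Beyond the length of the assignment the value is junk.
  positions : PathAssignment T → ℕ → ℕ → TransitionSystem.Vertex T
  positions Π∅            j       m = TransitionSystem.initial T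
  positions (Π [ π ↦ ρ ]) zero    m = Path.at ρ m
  positions (Π [ π ↦ ρ ]) (suc j) m = positions Π j m

module Hull {ℓ} (em : ExcludedMiddle ℓ) {k} (T : TransitionSystem k ℓ)
            (table : List (Goal k)) where
  open TransitionSystem T
  open Path

  -- Arguments of a term carry vertices but no edge proofs, so they fix an assignment only up to its
  -- values. Rows of `g` past the end of the list are unconstrained.
  data Matches : List PathVariable → (ℕ → ℕ → Vertex) → PathAssignment T → Set ℓ where
    []  : ∀ {g} → Matches [] g Π∅
    _∷_ : ∀ {π vs g ρ Π} → g 0 ≗ at ρ → Matches vs (g ∘ suc) Π →
          Matches (π ∷ vs) g (Π [ π ↦ ρ ])

  record Witness (G : Goal k) (g : ℕ → ℕ → Vertex) : Set ℓ where
    constructor mkWitness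
    open Goal G
    field
      assignment : PathAssignment T
      matches    : Matches assigned g assignment
      path       : Path T
      start      : at path 0 ≡ rcnt assignment
      holds      : T ⊨[ assignment [ quantified ↦ path ] ] body

  follow : ∀ {G g} → Dec (Witness G g) → ℕ → Vertex
  follow (yes w) n = at (Witness.path w) (suc n)
  follow (no _)  n = initial

  -- The given witness only rules out `no`; the one returned is whatever `d` contains.
  follow-witness : ∀ {G G′ g} → G′ ≡ G → (d : Dec (Witness G′ g)) → Witness G g →
    Σ[ w ∈ Witness G g ] (∀ n → follow d n ≡ at (Witness.path w) (suc n))
  follow-witness refl (yes w) _ = w , λ _ → refl
  follow-witness refl (no ¬w) w = ⊥-elim (¬w w)

  ⟦_⟧ : Term (length table) → Vertex
  ⟦ root ⟧          = initial
  -- The type being decided does not mention `n`, so all positions are read off one and the same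
  -- chosen path.
  ⟦ witness i n f ⟧ = follow (em {Witness (table ! i) (λ j m → ⟦ f j m ⟧)}) n

  -- Deciding the edge relation brings it down to the lowest universe.
  hull : TransitionSystem k 0ℓ
  hull = record
    { Vertex  = Term (length table)
    ; Edge    = λ t u → True (em {Edge ⟦ t ⟧ ⟦ u ⟧})
    ; initial = root
    ; label   = label ∘ ⟦_⟧
    }

  image : Path hull → Path T
  image ρ .at   = ⟦_⟧ ∘ at ρ
  image ρ .edge = toWitness ∘ edge ρ

  _≈_ : PathAssignment hull → PathAssignment T → Set ℓ
  Π′ ≈ Π = Matches (variables Π′) (λ j m → ⟦ positions Π′ j m ⟧) Π

  ≈-suffix : ∀ Π′ {Π} j → Π′ ≈ Π → (Π′ [ j ,∞⟩) ≈ (Π [ j ,∞⟩)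
  ≈-suffix Π∅              j []       = []
  ≈-suffix (Π′ [ π ↦ ρ ]) j (eq ∷ eqs) = (λ m → eq (m + j)) ∷ ≈-suffix Π′ j eqs

  ≈-rcnt : ∀ Π′ {Π} → Π′ ≈ Π → ⟦ rcnt Π′ ⟧ ≡ rcnt Π
  ≈-rcnt Π∅             []       = refl
  ≈-rcnt (Π′ [ π ↦ ρ ]) (eq ∷ _) = eq 0

  ≈-atom⁺ : ∀ {a v} Π′ {Π} → Π′ ≈ Π → hull ⊨[ Π′ ] a ⟨ v ⟩ → T ⊨[ Π ] a ⟨ v ⟩
  ≈-atom⁺ {v = v} (Π′ [ π ↦ ρ ]) (eq ∷ eqs) p with π ≟ v
  ... | no _  = ≈-atom⁺ Π′ eqs p
  ≈-atom⁺ {a} (Π′ [ π ↦ ρ ]) (eq ∷ eqs) (just p) | yes _ =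
    just (subst (λ u → a ∈ label u) (eq 0) p)

  ≈-atom⁻ : ∀ {a v} Π′ {Π} → Π′ ≈ Π → T ⊨[ Π ] a ⟨ v ⟩ → hull ⊨[ Π′ ] a ⟨ v ⟩
  ≈-atom⁻ Π∅ [] ()
  ≈-atom⁻ {v = v} (Π′ [ π ↦ ρ ]) (eq ∷ eqs) p with π ≟ v
  ... | no _  = ≈-atom⁻ Π′ eqs p
  ≈-atom⁻ {a} (Π′ [ π ↦ ρ ]) (eq ∷ eqs) (just p) | yes _ =
    just (subst (λ u → a ∈ label u) (sym (eq 0)) p)

  -- The assignment Π₀ that the choice operator returns need not be Π: it has
  -- the same vertices, but possibly different proofs that they form paths.
  realise : ∀ {π ψ Π} Π′ → goal (variables Π′) π ψ ∈ˡ table → Π′ ≈ Π → T ⊨[ Π ] ∃[ π ] ψ →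
    Σ[ ρ′ ∈ Path hull ] at ρ′ 0 ≡ rcnt Π′ ×
    Σ[ Π₀ ∈ PathAssignment T ] Σ[ ρ ∈ Path T ]
      (Π′ [ π ↦ ρ′ ]) ≈ (Π₀ [ π ↦ ρ ]) × (T ⊨[ Π₀ [ π ↦ ρ ] ] ψ)
  realise {Π = Π} Π′ goal∈ Π′≈Π (ρ₁ , start₁ , sat₁)
    with mkWitness Π₀ Π′≈Π₀ ρ start sat₀ , follows ←
      follow-witness (sym (lookup-index goal∈)) em (mkWitness Π Π′≈Π ρ₁ start₁ sat₁)
    = ρ′ , refl , Π₀ , ρ , on-ρ ∷ Π′≈Π₀ , sat₀
    where
    vertex : ℕ → Term (length table)
    vertex zero    = rcnt Π′
    vertex (suc n) = witness (index goal∈) n (positions Π′)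

    on-ρ : ∀ n → ⟦ vertex n ⟧ ≡ at ρ n
    on-ρ zero    = trans (≈-rcnt Π′ Π′≈Π₀) (sym start)
    on-ρ (suc n) = follows n

    ρ′ : Path hull
    ρ′ .at     = vertex
    ρ′ .edge n = fromWitness (subst₂ Edge (sym (on-ρ n)) (sym (on-ρ (suc n))) (edge ρ n))

  mutual
    -- Negation swaps the two directions, hence the mutual induction. `Π` varies in it because
    -- `realise` may replace it by `Π₀`, and `vs` is separate because taking suffixes preserves
    -- `variables Π′` only propositionally.
    ⊨-eval : ∀ {vs Π} ψ Π′ → variables Π′ ≡ vs → goals vs ψ ⊆ table → Π′ ≈ Π →
      hull ⊨[ Π′ ] ψ → T ⊨[ Π ] ψ
    ⊨-eval (a ⟨ π ⟩) Π′ vars sub e p = ≈-atom⁺ Π′ e p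
    ⊨-eval (~ ψ) Π′ vars sub e p q = p (⊨-reflect ψ Π′ vars sub e q)
    ⊨-eval (ψ ∨ χ) Π′ vars sub e (inj₁ p) =
      inj₁ (⊨-eval ψ Π′ vars (⊆-trans (xs⊆xs++ys _ _) sub) e p)
    ⊨-eval (ψ ∨ χ) Π′ vars sub e (inj₂ p) =
      inj₂ (⊨-eval χ Π′ vars (⊆-trans (xs⊆ys++xs _ _) sub) e p)
    ⊨-eval (𝐗 ψ) Π′ vars sub e p =
      ⊨-eval ψ _ (trans (variables-suffix Π′ 1) vars) sub (≈-suffix Π′ 1 e) p
    ⊨-eval (ψ 𝐔 χ) Π′ vars sub e (j , p , q) =
      j ,
      ⊨-eval χ _ (trans (variables-suffix Π′ j) vars) (⊆-trans (xs⊆ys++xs _ _) sub)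
        (≈-suffix Π′ j e) p ,
      λ i i<j → ⊨-eval ψ _ (trans (variables-suffix Π′ i) vars) (⊆-trans (xs⊆xs++ys _ _) sub)
        (≈-suffix Π′ i e) (q i i<j)
    ⊨-eval (∃[ π ] ψ) Π′ vars sub e (ρ , start , p) =
      image ρ , trans (cong ⟦_⟧ start) (≈-rcnt Π′ e) ,
      ⊨-eval ψ (Π′ [ π ↦ ρ ]) (cong (π ∷_) vars) (⊆-trans (xs⊆x∷xs _ _) sub)
        ((λ _ → refl) ∷ e) p
    ⊨-eval {Π = Π} (∀[ π ] ψ) Π′ refl sub e p ρ start with em {T ⊨[ Π [ π ↦ ρ ] ] ψ}
    ... | yes q = q
    ... | no ¬q
      -- The counterexample `ρ` need not come from the hull, but `realise` supplies one that does,
      -- and `p` applies to it.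
      with ρ′ , start′ , _ , _ , e′ , ¬q₀ ← realise Π′ (sub (here refl)) e (ρ , start , ¬q)
      = ⊥-elim (¬q₀ (⊨-eval ψ (Π′ [ π ↦ ρ′ ]) refl (⊆-trans (xs⊆x∷xs _ _) sub) e′ (p ρ′ start′)))

    ⊨-reflect : ∀ {vs Π} ψ Π′ → variables Π′ ≡ vs → goals vs ψ ⊆ table → Π′ ≈ Π →
      T ⊨[ Π ] ψ → hull ⊨[ Π′ ] ψ
    ⊨-reflect (a ⟨ π ⟩) Π′ vars sub e p = ≈-atom⁻ Π′ e p
    ⊨-reflect (~ ψ) Π′ vars sub e p q = p (⊨-eval ψ Π′ vars sub e q)
    ⊨-reflect (ψ ∨ χ) Π′ vars sub e (inj₁ p) =
      inj₁ (⊨-reflect ψ Π′ vars (⊆-trans (xs⊆xs++ys _ _) sub) e p)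
    ⊨-reflect (ψ ∨ χ) Π′ vars sub e (inj₂ p) =
      inj₂ (⊨-reflect χ Π′ vars (⊆-trans (xs⊆ys++xs _ _) sub) e p)
    ⊨-reflect (𝐗 ψ) Π′ vars sub e p =
      ⊨-reflect ψ _ (trans (variables-suffix Π′ 1) vars) sub (≈-suffix Π′ 1 e) p
    ⊨-reflect (ψ 𝐔 χ) Π′ vars sub e (j , p , q) =
      j ,
      ⊨-reflect χ _ (trans (variables-suffix Π′ j) vars) (⊆-trans (xs⊆ys++xs _ _) sub)
        (≈-suffix Π′ j e) p ,
      λ i i<j → ⊨-reflect ψ _ (trans (variables-suffix Π′ i) vars) (⊆-trans (xs⊆xs++ys _ _) sub)
        (≈-suffix Π′ i e) (q i i<j)
    ⊨-reflect (∃[ π ] ψ) Π′ refl sub e p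
      with ρ′ , start′ , _ , _ , e′ , p₀ ← realise Π′ (sub (here refl)) e p
      = ρ′ , start′ , ⊨-reflect ψ (Π′ [ π ↦ ρ′ ]) refl (⊆-trans (xs⊆x∷xs _ _) sub) e′ p₀
    ⊨-reflect (∀[ π ] ψ) Π′ vars sub e p ρ start =
      ⊨-reflect ψ (Π′ [ π ↦ ρ ]) (cong (π ∷_) vars) (⊆-trans (xs⊆x∷xs _ _) sub)
        ((λ _ → refl) ∷ e) (p (image ρ) (trans (cong ⟦_⟧ start) (≈-rcnt Π′ e)))

proposition9 : ∀ {ℓ : Level} → ExcludedMiddle ℓ → Extensionality 0ℓ 0ℓ →
    ∀ {k : ℕ} (φ : Sentence k) → Satisfiable ℓ φ →
    Σ[ T ∈ TransitionSystem k 0ℓ ] SizeAtMostContinuum T × T ⊨ φ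
proposition9 em ext φ (T , sat) =
  -- The table lists exactly the goals of `formula`, so the inclusion starts out reflexive.
  hull , Term↣2^ℕ ext , ⊨-reflect formula Π∅ refl ⊆-refl [] sat
  where
  open Sentence φ
  open Hull em T (goals [] formula)
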